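{- Let $(S,+,\cdot,0,1)$ be a dually atomic bounded distributive lattice in which $\mathrm{DAtom}(S)$ is nonempty. If the graph $G(S)$ has no isolated vertex, then $G(S)$ is connected with $\mathrm{diam}(G(S))\le 4$.
   Context: In the lattice $(S,+,\cdot,0,1)$, $+$ denotes join, $\cdot$ denotes meet, $0$ is the least and $1$ the greatest element. The graph $G(S)$ is the simple graph with vertex set $S\setminus\{0,1\}$ in which two vertices $x,y$ are adjacent iff $x\ne y$ and $x\cdot y\neq 0$. A dual atom of $S$ is an element $d$ with $0<d<1$ such that $d\le y\le 1$ implies $y=d$ or $y=1$; $\mathrm{DAtom}(S)$ is the set of dual atoms. The bounded lattice $S$ is dually atomic if for every $x\in S\setminus\{1\}$ there exists a dual atom $m$ with $x\le m$. The diameter of a graph is the greatest distance between any two of its vertices. -}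

module Defs where

open import Level using (Level; _⊔_) renaming (suc to lsuc)
open import Data.Nat.Base using (ℕ; suc) renaming (_≤_ to _≤ℕ_)
open import Data.Fin.Base using (Fin; zero; suc; inject₁; fromℕ)
open import Data.Product.Base using (Σ; ∃-syntax; _×_; _,_; proj₁; proj₂)
open import Data.Sum.Base using (_⊎_)
open import Function.Base using (_∘_)
open import Function.Definitions using (Injective)
open import Relation.Binary.Bundles using (Setoid)
open import Relation.Binary.Core using (Rel)
open import Relation.Binary.Definitions using (Symmetric; Irreflexive; _Respects₂_)
open import Relation.Binary.Lattice.Bundles using (BoundedLattice)
open import Relation.Binary.Lattice.Structures using (IsDistributiveLattice)
open import Relation.Binary.PropositionalEquality.Core using (_≡_)
open import Relation.Nullary.Negation.Core using (¬_)
import Relation.Binary.Construct.NonStrictToStrict as ToStrict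
import Relation.Binary.Construct.On as On

record SimpleGraph (v e r : Level) : Set (lsuc (v ⊔ e ⊔ r)) where
  infix 4 _~_
  field
    vertices : Setoid v e
  open Setoid vertices public using () renaming (Carrier to Vertex; _≈_ to _≈ᵛ_)
  field
    _~_      : Rel Vertex r
    ~-sym    : Symmetric _~_
    ~-irrefl : Irreflexive _≈ᵛ_ _~_
    ~-resp-≈ : _~_ Respects₂ _≈ᵛ_

module _ {v e r : Level} (G : SimpleGraph v e r) where
  open SimpleGraph G

  Isolated : Vertex → Set (v ⊔ r)
  Isolated x = ∀ y → ¬ (x ~ y)

  -- A path with n edges has n + 1 pairwise distinct vertices; for n = 0 its
  -- two ends are equal.
  record Path (x y : Vertex) (n : ℕ) : Set (v ⊔ e ⊔ r) where
    field
      vertex   : Fin (suc n) → Vertex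
      source   : vertex zero ≈ᵛ x
      target   : vertex (fromℕ n) ≈ᵛ y
      edge     : ∀ (i : Fin n) → vertex (inject₁ i) ~ vertex (suc i)
      distinct : Injective _≡_ _≈ᵛ_ vertex

  Connected : Set (v ⊔ e ⊔ r)
  Connected = ∀ x y → ∃[ n ] Path x y n

  IsDistance : Vertex → Vertex → ℕ → Set (v ⊔ e ⊔ r)
  IsDistance x y d = Path x y d × (∀ n → Path x y n → d ≤ℕ n)

  -- The greatest distance, required to be attained by some pair of vertices.
  IsDiameter : ℕ → Set (v ⊔ e ⊔ r)
  IsDiameter D = (∃[ x ] ∃[ y ] IsDistance x y D)
               × (∀ x y d → IsDistance x y d → d ≤ℕ D)

module _ {c ℓ₁ ℓ₂ : Level} (S : BoundedLattice c ℓ₁ ℓ₂) where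
  open BoundedLattice S
  open ToStrict _≈_ _≤_ using (_<_)

  Distributive : Set (c ⊔ ℓ₁ ⊔ ℓ₂)
  Distributive = IsDistributiveLattice _≈_ _≤_ _∨_ _∧_

  DAtom : Carrier → Set (c ⊔ ℓ₁ ⊔ ℓ₂)
  DAtom d = ⊥ < d × d < ⊤ × (∀ y → d ≤ y → y ≤ ⊤ → y ≈ d ⊎ y ≈ ⊤)

  DuallyAtomic : Set (c ⊔ ℓ₁ ⊔ ℓ₂)
  DuallyAtomic = ∀ x → ¬ (x ≈ ⊤) → ∃[ m ] (DAtom m × x ≤ m)

  G : SimpleGraph (c ⊔ ℓ₁) ℓ₁ ℓ₁
  G = record
    { vertices = On.setoid setoid underlying
    ; _~_      = λ (x , _) (y , _) → ¬ (x ≈ y) × ¬ (x ∧ y ≈ ⊥)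
    ; ~-sym    = λ {(x , _)} {(y , _)} (x≉y , xy≉0) →
                   x≉y ∘ Eq.sym , xy≉0 ∘ Eq.trans (∧-comm x y)
    ; ~-irrefl = λ x≈y (x≉y , _) → x≉y x≈y
    ; ~-resp-≈ = (λ y≈z (x≉y , xy≉0) →
                     (λ x≈z → x≉y (Eq.trans x≈z (Eq.sym y≈z)))
                   , (λ xz≈0 → xy≉0 (Eq.trans (∧-cong Eq.refl y≈z) xz≈0)))
               , (λ y≈z (y≉x , yx≉0) →
                     (λ z≈x → y≉x (Eq.trans y≈z z≈x))
                   , (λ zx≈0 → yx≉0 (Eq.trans (∧-cong y≈z Eq.refl) zx≈0)))
    }
    where
    open import Relation.Binary.Lattice.Properties.MeetSemilattice meetSemilattice
      using (∧-comm; ∧-cong)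

    underlying : (Σ Carrier λ x → ¬ (x ≈ ⊥) × ¬ (x ≈ ⊤)) → Carrier
    underlying = proj₁

{-# OPTIONS --safe #-}

-- If m and n are dual atoms with m ∧ n ≈ ⊥, then S ≅ [⊥, m] × [⊥, n], and
-- [⊥, m] ≅ [n, ⊤] has only two elements, so that m is isolated.  Hence any two
-- dual atoms have nonzero meet, and for dual atoms m ≥ x and n ≥ y the sequence
-- x, m, n, y is a walk, up to repetitions.  So the diameter is in fact at most 3.

module Submission where

open import Defs
open import Level using (Level; _⊔_; Lift; lift; lower)
open import Axiom.ExcludedMiddle using (ExcludedMiddle)
open import Data.Nat.Base using (ℕ; zero; suc; _≤_; z≤n; s≤s)
open import Data.Nat.Properties using (≤-trans; ≤-refl; m≤n⇒m≤1+n; m≤n⇒m<n∨m≡n; ≤-pred)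
open import Data.Fin.Base using (Fin; zero; suc; inject₁)
open import Data.Fin.Properties using (any?; suc-injective)
open import Data.Product.Base using (∃-syntax; _×_; _,_; proj₁; proj₂)
open import Data.Sum.Base using (_⊎_; inj₁; inj₂)
open import Data.Vec.Functional using (_∷_)
open import Function.Base using (_∘_)
open import Function.Definitions using (Injective)
open import Relation.Binary.Bundles using (module Setoid)
open import Relation.Binary.Definitions using (Decidable)
open import Relation.Binary.Lattice.Bundles using (BoundedLattice)
open import Relation.Binary.Lattice.Structures using (module IsDistributiveLattice)
open import Relation.Binary.PropositionalEquality.Core using (_≡_; refl; cong)
open import Relation.Nullary.Decidable.Core using (Dec; yes; no; map′)
open import Relation.Nullary.Negation.Core using (¬_; contradiction)
open import Relation.Unary using (Pred; Satisfiable) renaming (Decidable to Decidable₁)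

-- Via `Lift`: paths and vertex equality live at lower universe levels than the excluded middle
-- assumed in `theorem3p4`.
lower-em : ∀ {a} b → ExcludedMiddle (a ⊔ b) → ExcludedMiddle a
lower-em b em {P} = map′ lower lift (em {Lift b P})

-- A downward search from `b`: wherever `P` fails, the bound drops by one.
greatest : ∀ {p} {P : Pred ℕ p} → Decidable₁ P → Satisfiable P →
           ∀ b → (∀ n → P n → n ≤ b) → ∃[ m ] (P m × (∀ n → P n → n ≤ m))
greatest P? (k , pk) b bound with P? b
... | yes pb = b , pb , bound
greatest P? (k , pk) zero bound | no ¬pb with bound k pk
-- The search cannot run out at 0: the bound forces the witness `k` itself to be 0.
... | z≤n = contradiction pk ¬pb
greatest {P = P} P? sat (suc b) bound | no ¬pb = greatest P? sat b bound′
  where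
  bound′ : ∀ n → P n → n ≤ b
  bound′ n pn with m≤n⇒m<n∨m≡n (bound n pn)
  ... | inj₁ n<1+b = ≤-pred n<1+b
  ... | inj₂ refl  = contradiction pn ¬pb

module _ {v e r : Level} (G : SimpleGraph v e r) where
  open SimpleGraph G
  open Setoid vertices using () renaming (refl to ≈-refl; sym to ≈-sym; trans to ≈-trans)

  -- Vertices of a `Path` are distinct, so removing repetitions from a walk can shorten it; only an
  -- upper bound on the length survives.
  Path≤ : Vertex → Vertex → ℕ → Set (v ⊔ e ⊔ r)
  Path≤ x y n = ∃[ k ] (Path G x y k × k ≤ n)

  path-refl : ∀ x → Path G x x 0
  path-refl x = record
    { vertex   = λ _ → x
    ; source   = ≈-refl
    ; target   = ≈-refl
    ; edge     = λ ()
    ; distinct = distinct′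
    }
    where
    distinct′ : Injective _≡_ _≈ᵛ_ (λ (_ : Fin 1) → x)
    distinct′ {zero} {zero} _ = refl

  resp-source : ∀ {x x′ y n} → x ≈ᵛ x′ → Path G x′ y n → Path G x y n
  resp-source x≈x′ p = record
    { vertex   = vertex
    ; source   = ≈-trans source (≈-sym x≈x′)
    ; target   = target
    ; edge     = edge
    ; distinct = distinct
    } where open Path p

  tail : ∀ {x y n} (p : Path G x y (suc n)) → Path G (Path.vertex p (suc zero)) y n
  tail p = record
    { vertex   = vertex ∘ suc
    ; source   = ≈-refl
    ; target   = target
    ; edge     = edge ∘ suc
    ; distinct = suc-injective ∘ distinct
    } where open Path p

  -- Serves to cut out a loop: the part of `p` before its vertex `i` is dropped.
  suffix : ∀ {x y n} (p : Path G x y n) (i : Fin (suc n)) → Path≤ (Path.vertex p i) y n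
  suffix p zero = _ , resp-source (Path.source p) p , ≤-refl
  suffix {n = suc n} p (suc i) with suffix (tail p) i
  ... | k , q , k≤n = k , q , m≤n⇒m≤1+n k≤n

  cons : ∀ {x x′ y n} → x ~ x′ → (p : Path G x′ y n) →
         (∀ i → ¬ (x ≈ᵛ Path.vertex p i)) → Path G x y (suc n)
  cons {x} {n = n} x~x′ p x∉p = record
    { vertex   = x ∷ vertex
    ; source   = ≈-refl
    ; target   = target
    ; edge     = edge′
    ; distinct = distinct′
    }
    where
    open Path p

    edge′ : ∀ (i : Fin (suc n)) → (x ∷ vertex) (inject₁ i) ~ vertex i
    edge′ zero    = proj₁ ~-resp-≈ (≈-sym source) x~x′
    edge′ (suc i) = edge i

    distinct′ : Injective _≡_ _≈ᵛ_ (x ∷ vertex)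
    distinct′ {zero}  {zero}  _  = refl
    distinct′ {zero}  {suc j} eq = contradiction eq (x∉p j)
    distinct′ {suc i} {zero}  eq = contradiction (≈-sym eq) (x∉p i)
    distinct′ {suc i} {suc j} eq = cong suc (distinct eq)

  -- Extends a walk by one step while keeping it a path. If `x` already occurs on `p`, the suffix
  -- from that occurrence is taken instead. The first alternative allows consecutive vertices of the
  -- walk to coincide.
  prepend : Decidable _≈ᵛ_ → ∀ {x x′ y n} → x ≈ᵛ x′ ⊎ x ~ x′ →
            Path≤ x′ y n → Path≤ x y (suc n)
  prepend _≟_ (inj₁ x≈x′) (k , p , k≤n) = k , resp-source x≈x′ p , m≤n⇒m≤1+n k≤n
  prepend _≟_ {x} (inj₂ x~x′) (k , p , k≤n) with any? (λ i → x ≟ Path.vertex p i)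
  ... | no x∉p = suc k , cons x~x′ p (λ i eq → x∉p (i , eq)) , s≤s k≤n
  ... | yes (i , x≈pᵢ) with suffix p i
  ...   | j , q , j≤k = j , resp-source x≈pᵢ q , m≤n⇒m≤1+n (≤-trans j≤k k≤n)

  bounded-diameter : ExcludedMiddle (v ⊔ e ⊔ r) → Vertex → ∀ b → (∀ x y → Path≤ x y b) →
                     Connected G × (∃[ D ] (IsDiameter G D × D ≤ b))
  bounded-diameter em x₀ b short = connected , D , ((attained , upper) , D≤b)
    where
    connected : Connected G
    connected x y = let k , p , _ = short x y in k , p

    Attained : Pred ℕ (v ⊔ e ⊔ r)
    Attained d = ∃[ x ] ∃[ y ] IsDistance G x y d

    distance≤b : ∀ d → Attained d → d ≤ b
    distance≤b d (x , y , _ , least) = let k , p , k≤b = short x y in ≤-trans (least k p) k≤b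

    -- The distance 0 from `x₀` to itself makes the set of distances nonempty.
    maximum = greatest (λ _ → em) (0 , x₀ , x₀ , path-refl x₀ , λ _ _ → z≤n) b distance≤b
    D        = proj₁ maximum
    attained = proj₁ (proj₂ maximum)
    D≤b      = distance≤b D attained

    upper : ∀ x y d → IsDistance G x y d → d ≤ D
    upper x y d dist = proj₂ (proj₂ maximum) d (x , y , dist)

module _ {c ℓ₁ ℓ₂ : Level} (S : BoundedLattice c ℓ₁ ℓ₂) where
  open BoundedLattice S renaming (_≤_ to _⊑_; refl to ⊑-refl; trans to ⊑-trans)
  open SimpleGraph (G S) using (Vertex; _≈ᵛ_; _~_)

  ≤⊥⇒≈⊥ : ∀ {x} → x ⊑ ⊥ → x ≈ ⊥
  ≤⊥⇒≈⊥ x≤⊥ = antisym x≤⊥ (minimum _)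

  datom-vertex : ∀ {m} → DAtom S m → Vertex
  datom-vertex {m} ((_ , ⊥≉m) , (_ , m≉⊤) , _) = m , ⊥≉m ∘ Eq.sym , m≉⊤

  datom-∧≉⊥ : Distributive S → ¬ (∃[ x ] Isolated (G S) x) →
              ∀ {m n} → DAtom S m → DAtom S n → ¬ (m ∧ n ≈ ⊥)
  datom-∧≉⊥ dist noIsolated {m} {n} dm@(_ , _ , m-max) (_ , _ , n-max) mn≈⊥ =
    noIsolated (datom-vertex dm , isolated)
    where
    isolated : Isolated (G S) (datom-vertex dm)
    isolated (z , _ , z≉⊤) (m≉z , mz≉⊥)
      -- Under the isomorphism `t ↦ n ∨ t` from [⊥, m] to [n, ⊤], the element `m ∧ z` goes to `n` or
      -- `⊤`.
      with n-max (n ∨ (m ∧ z)) (x≤x∨y _ _) (maximum _)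
    -- Here `m ∧ z` lies below both `m` and `n`, hence is `⊥`, against adjacency.
    ... | inj₁ eq = mz≉⊥ (≤⊥⇒≈⊥ (⊑-trans
                      (∧-greatest (x∧y≤x m z) (⊑-trans (y≤x∨y n _) (reflexive eq)))
                      (reflexive mn≈⊥)))
    ... | inj₂ eq with m-max z m≤z (maximum z)
      where
      m≤z : m ⊑ z
      -- By distributivity, `m` is below `(m ∧ n) ∨ (m ∧ z)`, whose first term vanishes. So `z` is
      -- above the dual atom `m`, hence equal to `m` or `⊤`.
      m≤z = ⊑-trans (∧-greatest ⊑-refl (⊑-trans (maximum m) (reflexive (Eq.sym eq))))
           (⊑-trans (reflexive (IsDistributiveLattice.∧-distribˡ-∨ dist m n (m ∧ z)))
             (∨-least (⊑-trans (reflexive mn≈⊥) (minimum z))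
                      (⊑-trans (x∧y≤y m _) (x∧y≤y m z))))
    ...   | inj₁ z≈m = m≉z (Eq.sym z≈m)
    ...   | inj₂ z≈⊤ = z≉⊤ z≈⊤

  ≈ᵛ⊎~ : Decidable _≈ᵛ_ → ∀ x y → ¬ (proj₁ x ∧ proj₁ y ≈ ⊥) → x ≈ᵛ y ⊎ x ~ y
  ≈ᵛ⊎~ _≟_ x y xy≉⊥ with x ≟ y
  ... | yes x≈y = inj₁ x≈y
  ... | no  x≉y = inj₂ (x≉y , xy≉⊥)

  path≤3 : Decidable _≈ᵛ_ → Distributive S → DuallyAtomic S →
           ¬ (∃[ x ] Isolated (G S) x) → ∀ x y → Path≤ (G S) x y 3
  path≤3 _≟_ dist dually noIsolated x@(a , a≉⊥ , a≉⊤) y@(b , b≉⊥ , b≉⊤)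
    with dually a a≉⊤ | dually b b≉⊤
  ... | m , dm , a≤m | n , dn , b≤n =
    -- Since `a ⊑ m`, a zero meet would force `a ≈ ⊥`; the last step, from `n` to `b`, is symmetric.
    step x m′ (a≉⊥ ∘ λ am≈⊥ → ≤⊥⇒≈⊥ (⊑-trans (∧-greatest ⊑-refl a≤m) (reflexive am≈⊥)))
    (step m′ n′ (datom-∧≉⊥ dist noIsolated dm dn)
    (step n′ y (b≉⊥ ∘ λ nb≈⊥ → ≤⊥⇒≈⊥ (⊑-trans (∧-greatest b≤n ⊑-refl) (reflexive nb≈⊥)))
    (0 , path-refl (G S) y , z≤n)))
    where
    m′ = datom-vertex dm
    n′ = datom-vertex dn

    step : ∀ u w {z k} → ¬ (proj₁ u ∧ proj₁ w ≈ ⊥) →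
           Path≤ (G S) w z k → Path≤ (G S) u z (suc k)
    step u w uw≉⊥ = prepend (G S) _≟_ {u} {w} (≈ᵛ⊎~ _≟_ u w uw≉⊥)

theorem3p4 : ∀ {c ℓ₁ ℓ₂ : Level} → ExcludedMiddle (c ⊔ ℓ₁ ⊔ ℓ₂) →
    (S : BoundedLattice c ℓ₁ ℓ₂) →
    Distributive S →
    DuallyAtomic S →
    Satisfiable (DAtom S) →
    ¬ (∃[ x ] Isolated (G S) x) →
    Connected (G S) × (∃[ D ] (IsDiameter (G S) D × D ≤ 4))
theorem3p4 {c} {ℓ₁} {ℓ₂} em S dist dually (_ , dm) noIsolated =
  let connected , D , diameter , D≤3 =
        -- The given dual atom is the vertex that makes the graph nonempty.
        bounded-diameter (G S) (lower-em ℓ₂ em) (datom-vertex S dm) 3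
          (path≤3 S (λ _ _ → lower-em (c ⊔ ℓ₂) em) dist dually noIsolated)
  in connected , D , diameter , m≤n⇒m≤1+n D≤3
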